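{- For every integer $k \geq 4$ there exists a disconnected graph that is $k$-$\chi_g$-game-vertex-critical.
   Context: All graphs are simple, undirected and finite. The coloring game on a graph $G$ with color set $\{1,\ldots,k\}$ is played by Alice and Bob. Alice moves first and the players alternate turns; in each turn the player colors a previously uncolored vertex with a color from $\{1,\ldots,k\}$ different from the colors already given to its neighbors. If at some point there is an uncolored vertex having all colors $1,\ldots,k$ in its neighborhood, Bob wins; otherwise, if all vertices get colored, Alice wins. The game chromatic number $\chi_g(G)$ is the minimum $k$ for which Alice has a winning strategy on $G$. For $x\in V(G)$, $G-x$ is the graph obtained from $G$ by deleting $x$ and all edges incident with $x$. A graph $G$ is $k$-$\chi_g$-game-vertex-critical if $\chi_g(G)=k$ and $\chi_g(G-x)\neq\chi_g(G)$ for every $x\in V(G)$. -}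

module Defs where

open import Data.Empty using (⊥-elim)
open import Data.Fin using (Fin; zero; suc; punchIn; punchOut)
open import Data.Fin.Properties
  using (any?; all?; ¬∀⟶∃¬; pigeonhole; punchOut-injective; <⇒≢)
open import Data.Maybe using (Maybe; just; nothing)
open import Data.Maybe.Properties using (≡-dec; just-injective)
open import Data.Nat using (ℕ; zero; suc; pred; _≤_; _<_; z≤n; s≤s)
open import Data.Nat.Induction using (<-wellFounded)
open import Data.Nat.Properties using (≤-refl; n<1+n)
open import Data.Product using (∃; ∃-syntax; _×_; _,_; proj₁; proj₂)
open import Data.Vec using (Vec; []; _∷_; lookup; replicate; _[_]≔_)
open import Function using (_∘_)
open import Induction.WellFounded using (Acc; acc)
open import Level using (0ℓ)
open import Relation.Binary.Construct.Closure.ReflexiveTransitive using (Star)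
open import Relation.Binary.Core using (Rel)
open import Relation.Binary.Definitions using (Symmetric; Irreflexive; Decidable)
open import Relation.Binary.PropositionalEquality
  using (_≡_; _≢_; refl; sym; trans; cong)
open import Relation.Nullary using (¬_; Dec; yes; no)
open import Relation.Nullary.Decidable using (_×-dec_; _→-dec_; ¬?; decidable-stable)

import Data.Fin as Fin

record Graph (n : ℕ) : Set₁ where
  field
    Adj    : Rel (Fin n) 0ℓ
    symm   : Symmetric Adj
    irrefl : Irreflexive _≡_ Adj
    adj?   : Decidable Adj

open Graph public

Connected : ∀ {n} → Graph n → Set
Connected G = ∀ u v → Star (Adj G) u v

Disconnected : ∀ {n} → Graph n → Set
Disconnected G = ¬ Connected G

-- The remaining vertices are renumbered in an order-preserving way.
infixl 6 _-ᵍ_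
_-ᵍ_ : ∀ {n} → Graph n → Fin n → Graph (pred n)
_-ᵍ_ {suc n} G x = record
  { Adj    = λ u v → Adj G (punchIn x u) (punchIn x v)
  ; symm   = symm G
  ; irrefl = irrefl G ∘ cong (punchIn x)
  ; adj?   = λ u v → adj? G (punchIn x u) (punchIn x v)
  }

PartialColouring : ℕ → ℕ → Set
PartialColouring n k = Vec (Maybe (Fin k)) n

data Player : Set where
  alice bob : Player

module _ {n k : ℕ} (G : Graph n) where

  Uncoloured : PartialColouring n k → Fin n → Set
  Uncoloured c v = lookup c v ≡ nothing

  LegalMove : PartialColouring n k → Fin n → Fin k → Set
  LegalMove c v a = Uncoloured c v × (∀ w → Adj G v w → lookup c w ≢ just a)

  Blocked : PartialColouring n k → Set
  Blocked c = ∃[ v ] Uncoloured c v × (∀ a → ∃[ w ] Adj G v w × lookup c w ≡ just a)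

  -- Winning strategies for Alice from a given position, as game trees: one
  -- chosen reply at each turn of Alice, all legal moves at each turn of Bob.
  -- The player index is the player to move.
  data WinningStrategy : Player → PartialColouring n k → Set where
    finished    : ∀ {p c} → (∀ v → ¬ Uncoloured c v) → WinningStrategy p c
    alice-moves : ∀ {c} → ¬ Blocked c →
                  ∀ v a → LegalMove c v a →
                  WinningStrategy bob (c [ v ]≔ just a) →
                  WinningStrategy alice c
    bob-moves   : ∀ {c} → ¬ Blocked c →
                  (∀ v a → LegalMove c v a →
                   WinningStrategy alice (c [ v ]≔ just a)) →
                  WinningStrategy bob c

AliceWins : ∀ {n} → Graph n → ℕ → Set
AliceWins {n} G k = WinningStrategy {n} {k} G alice (replicate n nothing)

IsMinimum : (ℕ → Set) → ℕ → Set
IsMinimum P m = P m × (∀ j → P j → m ≤ j)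

-- The game is decidable, and Alice wins with as many colours as vertices, so
-- the minimum defining the game chromatic number exists.

module _ {n k : ℕ} (G : Graph n) where

  uncoloured? : (c : PartialColouring n k) → ∀ v → Dec (Uncoloured G c v)
  uncoloured? c v = ≡-dec Fin._≟_ (lookup c v) nothing

  legalMove? : (c : PartialColouring n k) → ∀ v a → Dec (LegalMove G c v a)
  legalMove? c v a = uncoloured? c v ×-dec
    all? λ w → adj? G v w →-dec ¬? (≡-dec Fin._≟_ (lookup c w) (just a))

  blocked? : (c : PartialColouring n k) → Dec (Blocked G c)
  blocked? c = any? λ v → uncoloured? c v ×-dec
    all? λ a → any? λ w → adj? G v w ×-dec ≡-dec Fin._≟_ (lookup c w) (just a)

#uncoloured : ∀ {n k} → PartialColouring n k → ℕ
#uncoloured []            = zero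
#uncoloured (just _  ∷ c) = #uncoloured c
#uncoloured (nothing ∷ c) = suc (#uncoloured c)

#uncoloured-decreases : ∀ {n k} (c : PartialColouring n k) v a → lookup c v ≡ nothing →
                        #uncoloured (c [ v ]≔ just a) < #uncoloured c
#uncoloured-decreases (nothing ∷ c) zero    a _  = ≤-refl
#uncoloured-decreases (just _  ∷ c) (suc v) a eq = #uncoloured-decreases c v a eq
#uncoloured-decreases (nothing ∷ c) (suc v) a eq = s≤s (#uncoloured-decreases c v a eq)

module _ {n k : ℕ} (G : Graph n) where

  winningStrategy? : ∀ p (c : PartialColouring n k) → Acc _<_ (#uncoloured c) →
                     Dec (WinningStrategy G p c)
  winningStrategy? p c (acc rec) with all? (¬? ∘ uncoloured? G c)
  ... | yes full = yes (finished full)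
  ... | no ¬full with blocked? G c
  ...   | yes b = no λ where
            (finished full)         → ¬full full
            (alice-moves ¬b _ _ _ _) → ¬b b
            (bob-moves ¬b _)        → ¬b b
  winningStrategy? alice c (acc rec) | no ¬full | no ¬b
    with any? (λ v → any? λ a → winningMove? v a)
    where
    winningMove? : ∀ v a → Dec (LegalMove G c v a × WinningStrategy G bob (c [ v ]≔ just a))
    winningMove? v a with legalMove? G c v a
    ... | no ¬l = no (¬l ∘ proj₁)
    ... | yes l with winningStrategy? bob (c [ v ]≔ just a)
                       (rec (#uncoloured-decreases c v a (proj₁ l)))
    ...   | yes s = yes (l , s)
    ...   | no ¬s = no (¬s ∘ proj₂)
  ... | yes (v , a , l , s) = yes (alice-moves ¬b v a l s)
  ... | no ¬m = no λ where
          (finished full)        → ¬full full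
          (alice-moves _ v a l s) → ¬m (v , a , l , s)
  winningStrategy? bob c (acc rec) | no ¬full | no ¬b
    with all? (λ v → all? λ a → answer? v a)
    where
    answer? : ∀ v a → Dec (LegalMove G c v a → WinningStrategy G alice (c [ v ]≔ just a))
    answer? v a with legalMove? G c v a
    ... | no ¬l = yes (⊥-elim ∘ ¬l)
    ... | yes l with winningStrategy? alice (c [ v ]≔ just a)
                       (rec (#uncoloured-decreases c v a (proj₁ l)))
    ...   | yes s = yes (λ _ → s)
    ...   | no ¬s = no (λ f → ¬s (f l))
  ... | yes f = yes (bob-moves ¬b f)
  ... | no ¬f = no λ where
          (finished full) → ¬full full
          (bob-moves _ f) → ¬f f

aliceWins? : ∀ {n} (G : Graph n) k → Dec (AliceWins G k)
aliceWins? G k = winningStrategy? G alice _ (<-wellFounded _)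

¬blocked : ∀ {n} (G : Graph n) (c : PartialColouring n n) → ¬ Blocked G c
¬blocked {suc m} G c (v , v-unc , nbr) =
  let i , j , i<j , eq = pigeonhole (n<1+n m) (λ a → punchOut (v≢ a))
  in <⇒≢ i<j (just-injective (trans (sym (colour i))
       (trans (cong (lookup c) (punchOut-injective (v≢ i) (v≢ j) eq)) (colour j))))
  where
  colour : ∀ a → lookup c (proj₁ (nbr a)) ≡ just a
  colour a = proj₂ (proj₂ (nbr a))

  v≢ : ∀ a → v ≢ proj₁ (nbr a)
  v≢ a eq with () ← trans (sym v-unc) (trans (cong (lookup c) eq) (colour a))

module _ {n : ℕ} (G : Graph n) where

  legalMove-exists : (c : PartialColouring n n) → ¬ (∀ v → ¬ Uncoloured G c v) →
                     ∃[ v ] ∃[ a ] LegalMove G c v a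
  legalMove-exists c ¬full =
    decidable-stable (any? λ v → any? λ a → legalMove? G c v a) λ ¬move →
      ¬full λ v v-unc → ¬blocked G c (v , v-unc , λ a →
        decidable-stable (any? λ w → adj? G v w ×-dec ≡-dec Fin._≟_ (lookup c w) (just a))
          λ ¬w → ¬move (v , a , v-unc , λ w vw eq → ¬w (w , vw , eq)))

  enoughColours : ∀ p (c : PartialColouring n n) → Acc _<_ (#uncoloured c) →
                  WinningStrategy G p c
  enoughColours bob c (acc rec) = bob-moves (¬blocked G c) λ v a l →
    enoughColours alice _ (rec (#uncoloured-decreases c v a (proj₁ l)))
  enoughColours alice c (acc rec) with all? (¬? ∘ uncoloured? G c)
  ... | yes full = finished full
  ... | no ¬full with v , a , l ← legalMove-exists c ¬full =
    alice-moves (¬blocked G c) v a l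
      (enoughColours bob _ (rec (#uncoloured-decreases c v a (proj₁ l))))

minimum : ∀ {P : ℕ → Set} → (∀ k → Dec (P k)) → ∀ n → P n → ∃ (IsMinimum P)
minimum P? n pn with P? zero
... | yes p0 = zero , p0 , λ _ _ → z≤n
minimum P? zero    pn | no ¬p0 = ⊥-elim (¬p0 pn)
minimum P? (suc n) pn | no ¬p0 with m , pm , least ← minimum (P? ∘ suc) n pn =
  suc m , pm , λ where
    zero    p0 → ⊥-elim (¬p0 p0)
    (suc j) pj → s≤s (least j pj)

minimumColours : ∀ {n} (G : Graph n) → ∃ (IsMinimum (AliceWins G))
minimumColours {n} G =
  minimum (aliceWins? G) n (enoughColours G alice _ (<-wellFounded _))

χg : ∀ {n} → Graph n → ℕ
χg G = proj₁ (minimumColours G)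

χg-isMinimum : ∀ {n} (G : Graph n) → IsMinimum (AliceWins G) (χg G)
χg-isMinimum G = proj₂ (minimumColours G)

GameVertexCritical : ∀ {n} → ℕ → Graph n → Set
GameVertexCritical k G = χg G ≡ k × (∀ x → χg (G -ᵍ x) ≢ χg G)

{-# OPTIONS --safe #-}
-- The witness is K₁ together with the complete multipartite graph on k parts of
-- size 2.  With k colours Bob wins as soon as some part carries two colours, since
-- the k parts then need at least k + 1 colours.  On the whole graph Alice starts
-- with the isolated vertex and from then on copies Bob's move on the other vertex
-- of the same part, so no part is ever split.  In a vertex-deleted subgraph either
-- every vertex has a partner, or exactly two have none and Bob answers one with the
-- other; so Alice is the first to enter a part of size 2, and Bob splits it.
module Submission where

open import Defs
open import Data.Fin using (Fin; zero; suc; punchIn; punchOut; splitAt; join; _↑ˡ_; _≟_)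
open import Data.Fin.Properties
  using (any?; all?; suc-injective; injective⇒≤; punchIn-injective; punchInᵢ≢i; punchIn-punchOut;
         punchOut-injective; splitAt-join; join-splitAt; splitAt-↑ˡ)
open import Data.Maybe using (Maybe; just; nothing)
open import Data.Maybe.Properties using (≡-dec; just-injective)
open import Data.Nat using (ℕ; zero; suc; _+_; _≤_; _<_; _≥_; z≤n; s≤s)
open import Data.Nat.Induction using (<-wellFounded)
open import Data.Nat.Properties using (≤-antisym; ≤-trans; <-trans; <⇒≱; 1+n≰n)
open import Data.Product using (Σ-syntax; ∃-syntax; _×_; _,_; proj₁; proj₂)
open import Data.Sum using (_⊎_; inj₁; inj₂; reduce; swap)
open import Data.Sum.Properties using (swap-involutive)
open import Data.Vec using ([]; _∷_; lookup; replicate; _[_]≔_)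
open import Data.Vec.Properties using (lookup∘update; lookup∘update′; lookup-replicate)
open import Function using (_∘_; id)
open import Function.Definitions using (Injective)
open import Induction.WellFounded using (Acc; acc)
open import Relation.Binary.Construct.Closure.ReflexiveTransitive using (Star; ε; _◅_)
open import Relation.Binary.PropositionalEquality
  using (_≡_; _≢_; refl; sym; trans; cong; subst; subst₂; ≢-sym)
open import Relation.Nullary using (¬_; Dec; yes; no; contradiction)
open import Relation.Nullary.Decidable using (_×-dec_; ¬?; decidable-stable; map′)

private variable
  k m n : ℕ

-- Injections and missed values in finite sets

injective⇒hits : {h : Fin m → Fin m} → Injective _≡_ _≡_ h → ∀ y → ∃[ i ] h i ≡ y
injective⇒hits {m = suc m} {h} inj y with any? (λ i → h i ≟ y)
... | yes hit = hit
... | no ¬hit = contradiction (injective⇒≤ (inj ∘ punchOut-injective (y≢ _) (y≢ _))) 1+n≰n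
  where
  y≢ : ∀ i → y ≢ h i
  y≢ i eq = ¬hit (i , sym eq)

-- If every value were hit, choosing preimages would inject `Fin k` into `Fin m`. Applied to
-- `lookup` of an explicit vector, this yields a colour or a vertex outside a short list.
<⇒misses : m < k → (h : Fin m → Fin k) → ∃[ y ] ∀ i → h i ≢ y
<⇒misses {m} {k} m<k h = decidable-stable (any? λ y → all? λ i → ¬? (h i ≟ y)) λ ¬miss →
  let hit : ∀ y → ∃[ i ] h i ≡ y
      hit y = decidable-stable (any? λ i → h i ≟ y) λ ¬hit → ¬miss (y , λ i eq → ¬hit (i , eq))
  in <⇒≱ m<k (injective⇒≤ {f = proj₁ ∘ hit} λ {y} {z} eq →
       trans (sym (proj₂ (hit y))) (trans (cong h eq) (proj₂ (hit z))))

module _ {n k : ℕ} where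

  ∅ : PartialColouring n k
  ∅ = replicate n nothing

  -- Absence from the whole board makes the colour legal at every uncoloured vertex, whatever the
  -- edges are.
  Unused : Fin k → PartialColouring n k → Set
  Unused a c = ∀ w → lookup c w ≢ just a

  ∅-unused : ∀ a → Unused a ∅
  ∅-unused a w eq with () ← trans (sym (lookup-replicate w nothing)) eq

  move-unused : ∀ (c : PartialColouring n k) v {a b} → b ≢ a →
                Unused a c → Unused a (c [ v ]≔ just b)
  move-unused c v b≢a unused w eq with w ≟ v
  ... | yes refl = b≢a (just-injective (trans (sym (lookup∘update w c _)) eq))
  ... | no w≢v   = unused w (trans (sym (lookup∘update′ w≢v c _)) eq)

module _ {n k : ℕ} (G : Graph n) where

  Proper : PartialColouring n k → Set
  Proper c = ∀ u v → Adj G u v → ∀ a → lookup c u ≡ just a → lookup c v ≢ just a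

  ∅-proper : Proper ∅
  ∅-proper u _ _ a eq _ = ∅-unused a u eq

  unused⇒legal : ∀ (c : PartialColouring n k) v {a} →
                 Uncoloured G c v → Unused a c → LegalMove G c v a
  unused⇒legal _ _ unc unused = unc , λ w _ → unused w

  move-proper : ∀ (c : PartialColouring n k) {v a} → LegalMove G c v a →
                Proper c → Proper (c [ v ]≔ just a)
  move-proper c {v} {a} (_ , legal) proper u w uw b cu cw with u ≟ v | w ≟ v
  ... | yes refl | yes refl = irrefl G refl uw
  ... | yes refl | no w≢v   = legal w uw
          (trans (sym (lookup∘update′ w≢v c _))
            (trans cw (trans (sym cu) (lookup∘update v c _))))
  ... | no u≢v   | yes refl = legal u (symm G uw)
          (trans (sym (lookup∘update′ u≢v c _))
            (trans cu (trans (sym cw) (lookup∘update v c _))))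
  ... | no u≢v   | no w≢v   = proper u w uw b
          (trans (sym (lookup∘update′ u≢v c _)) cu)
          (trans (sym (lookup∘update′ w≢v c _)) cw)

  move-extends : ∀ (c : PartialColouring n k) {v a} → Uncoloured G c v →
                 ∀ w b → lookup c w ≡ just b → lookup (c [ v ]≔ just a) w ≡ just b
  move-extends c {v} unc w b eq with w ≟ v
  ... | yes refl with () ← trans (sym unc) eq
  ... | no w≢v   = trans (lookup∘update′ w≢v c _) eq

  ProperExtension : PartialColouring n k → Set
  ProperExtension c = Σ[ d ∈ (Fin n → Fin k) ] (∀ u v → Adj G u v → d u ≢ d v) ×
                             (∀ v a → lookup c v ≡ just a → d v ≡ a)

  coloured⇒extension : ∀ (c : PartialColouring n k) → Proper c →
                       (∀ v → ¬ Uncoloured G c v) → ProperExtension c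
  coloured⇒extension c proper full =
      proj₁ ∘ colour
    , (λ u v uv eq → proper u v uv _ (proj₂ (colour u))
                       (trans (proj₂ (colour v)) (cong just (sym eq))))
    , λ v a eq → just-injective (trans (sym (proj₂ (colour v))) eq)
    where
    colour : ∀ v → ∃[ a ] lookup c v ≡ just a
    colour v with lookup c v in eq
    ... | just a  = a , refl
    ... | nothing = contradiction eq (full v)

  legalMove : ∀ (c : PartialColouring n k) → ¬ Blocked G c →
              ∀ v → Uncoloured G c v → ∃[ a ] LegalMove G c v a
  legalMove c ¬b v unc = decidable-stable (any? λ a → legalMove? G c v a) λ ¬move →
    ¬b (v , unc , λ a →
      let used? = any? λ w → adj? G v w ×-dec ≡-dec _≟_ (lookup c w) (just a)
      in decidable-stable used? λ ¬w → ¬move (a , unc , λ w vw eq → ¬w (w , vw , eq)))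

  restrict : ∀ (c : PartialColouring n k) {v a} → Uncoloured G c v →
             ProperExtension (c [ v ]≔ just a) → ProperExtension c
  restrict c unc (d , proper , ext) = d , proper , λ w b → ext w b ∘ move-extends c unc w b

  -- Play one game to the end along the strategy, Bob colouring uncoloured vertices arbitrarily: the
  -- final board is a proper colouring extending `c`. Hence Alice has no winning strategy from a
  -- proper position without a proper extension.
  winning⇒extension : ∀ {p} (c : PartialColouring n k) → Proper c →
                      WinningStrategy G p c → ProperExtension c
  winning⇒extension c proper (finished full) = coloured⇒extension c proper full
  winning⇒extension c proper (alice-moves _ v a l s) =
    restrict c (proj₁ l) (winning⇒extension _ (move-proper c l proper) s)
  winning⇒extension c proper (bob-moves ¬b f) with any? (uncoloured? G c)
  ... | no full = coloured⇒extension c proper λ v unc → full (v , unc)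
  ... | yes (v , unc) with a , l ← legalMove c ¬b v unc =
    restrict c unc (winning⇒extension _ (move-proper c l proper) (f v a l))

-- Criticality in terms of Alice's wins

χg-unique : (G : Graph n) → IsMinimum (AliceWins G) k → χg G ≡ k
χg-unique G (wins , least) =
  ≤-antisym (proj₂ (χg-isMinimum G) _ wins) (least _ (proj₁ (χg-isMinimum G)))

χg-attained : (G : Graph n) → χg G ≡ k → AliceWins G k
χg-attained G eq = subst (AliceWins G) eq (proj₁ (χg-isMinimum G))

-- The minimum is attained, so a deleted subgraph with game chromatic number `k` would be won by
-- Alice with `k` colours.
critical : (G : Graph n) → AliceWins G k → (∀ j → AliceWins G j → k ≤ j) →
           (∀ x → ¬ AliceWins (G -ᵍ x) k) → GameVertexCritical k G
critical {k = k} G wins least deletion-loses = χg≡k , λ x eq →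
  deletion-loses x (χg-attained (G -ᵍ x) (trans eq χg≡k))
  where
  χg≡k : χg G ≡ k
  χg≡k = χg-unique G (wins , least)

-- Complete multipartite graphs with isolated vertices

-- A vertex with label nothing is isolated.
data Apart {A : Set} : Maybe A → Maybe A → Set where
  apart : ∀ {b b′} → b ≢ b′ → Apart (just b) (just b′)

apart-sym : ∀ {A} {x y : Maybe A} → Apart x y → Apart y x
apart-sym (apart b≢b′) = apart (≢-sym b≢b′)

apart-irrefl : ∀ {A} {x : Maybe A} → ¬ Apart x x
apart-irrefl (apart b≢b) = b≢b refl

apart-just : ∀ {A} {x y : Maybe A} → Apart x y →
             ∃[ b ] ∃[ b′ ] x ≡ just b × y ≡ just b′ × b ≢ b′
apart-just (apart b≢b′) = _ , _ , refl , refl , b≢b′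

apart? : ∀ x y → Dec (Apart {Fin k} x y)
apart? nothing  _        = no λ ()
apart? (just _) nothing  = no λ ()
apart? (just b) (just b′) = map′ apart (λ { (apart b≢b′) → b≢b′ }) (¬? (b ≟ b′))

multipartite : (Fin n → Maybe (Fin k)) → Graph n
multipartite part = record
  { Adj    = λ u v → Apart (part u) (part v)
  ; symm   = apart-sym
  ; irrefl = λ { refl → apart-irrefl }
  ; adj?   = λ u v → apart? (part u) (part v)
  }

-- Bob's play on graphs containing a complete k-partite graph

module _ {n k : ℕ} (G : Graph n) (part : Fin n → Maybe (Fin k))
         (apart⇒adj : ∀ {u v} → Apart (part u) (part v) → Adj G u v)
         (inhabited : ∀ b → ∃[ v ] part v ≡ just b) where

  -- Representatives of distinct parts are adjacent, so the `k` representatives form a clique.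
  transversal-injective : ∀ {j} {d : Fin n → Fin j} → (∀ u v → Adj G u v → d u ≢ d v) →
                          Injective _≡_ _≡_ (d ∘ proj₁ ∘ inhabited)
  transversal-injective proper {b} {b′} eq = decidable-stable (b ≟ b′) λ b≢b′ →
    proper _ _ (apart⇒adj (subst₂ Apart (sym (proj₂ (inhabited b)))
                                        (sym (proj₂ (inhabited b′))) (apart b≢b′))) eq

  -- A transversal uses all k colours, so the colour of u is that of some
  -- representative, which must lie in the part of u.
  part-colour : ∀ {d : Fin n → Fin k} → (∀ u v → Adj G u v → d u ≢ d v) →
                ∀ {u b} → part u ≡ just b → d u ≡ d (proj₁ (inhabited b))
  part-colour {d} proper {u} {b} ub
    with b′ , eq ← injective⇒hits (transversal-injective proper) (d u) with b ≟ b′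
  ... | yes refl = sym eq
  ... | no b≢b′  = contradiction (sym eq) (proper _ _ (apart⇒adj
                     (subst₂ Apart (sym ub) (sym (proj₂ (inhabited b′))) (apart b≢b′))))

  alice-needs : ∀ {j} → AliceWins G j → k ≤ j
  alice-needs win with d , proper , _ ← winning⇒extension G ∅ (∅-proper G) win =
    injective⇒≤ (transversal-injective proper)

  Partners : Fin n → Fin n → Set
  Partners u v = u ≢ v × ∃[ b ] part u ≡ just b × part v ≡ just b

  -- After Bob's `a′` on `v`, a winning strategy would still give a proper colouring with `k`
  -- colours, constant on each part by `part-colour`, against `a ≢ a′`.
  bob-splits : ∀ (c : PartialColouring n k) {u v a a′} → Proper G c → Partners u v →
               lookup c u ≡ just a → Uncoloured G c v → a ≢ a′ → Unused a′ c →
               ¬ WinningStrategy G bob c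
  bob-splits _ _ _ _ unc _ _ (finished full) = full _ unc
  bob-splits c {u} {v} {a} {a′} proper (_ , b , ub , vb) cu unc a≢a′ unused (bob-moves _ f)
    with l ← unused⇒legal G c v unc unused
    with d , dproper , ext ← winning⇒extension G _ (move-proper G c l proper) (f v a′ l) =
    a≢a′ (trans (sym (ext u a (move-extends G c unc u a cu)))
           (trans (part-colour dproper ub)
             (trans (sym (part-colour dproper vb)) (ext v a′ (lookup∘update v c _)))))

  -- What Bob exploits is the pairing of the other vertices among themselves: once only `v` and `v′`
  -- are coloured, any next vertex has an uncoloured partner.
  OnlyLonely : Fin n → Fin n → Set
  OnlyLonely v v′ = v ≢ v′ ×
    ∀ u → u ≢ v → u ≢ v′ → ∃[ w ] Partners u w × w ≢ v × w ≢ v′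

  -- If the opening vertex has a partner, Bob splits its part at once. Otherwise he answers on `v′`
  -- and splits the part entered by Alice's second move.
  alice-opens⇒loses : 4 ≤ k → (∀ v → (∃[ w ] Partners v w) ⊎ (∃[ v′ ] OnlyLonely v v′)) →
                      ¬ AliceWins G k
  alice-opens⇒loses (s≤s _) _ (finished full) =
    full (proj₁ (inhabited zero)) (lookup-replicate (proj₁ (inhabited zero)) nothing)
  alice-opens⇒loses 4≤k pairing (alice-moves _ v a l s) with pairing v
  ... | inj₁ (w , p@(v≢w , _))
    with a′ , fresh ← <⇒misses (≤-trans (s≤s (s≤s z≤n)) 4≤k) (lookup (a ∷ [])) =
    bob-splits _ (move-proper G ∅ l (∅-proper G)) p
      (lookup∘update v ∅ _)
      (trans (lookup∘update′ (≢-sym v≢w) ∅ _) (lookup-replicate w nothing))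
      (fresh zero) (move-unused ∅ v (fresh zero) (∅-unused a′)) s
  ... | inj₂ (v′ , v≢v′ , others) = second s
    where
    c₁ : PartialColouring n k
    c₁ = ∅ [ v ]≔ just a

    proper₁ : Proper G c₁
    proper₁ = move-proper G ∅ l (∅-proper G)

    uncoloured₁ : ∀ {w} → w ≢ v → Uncoloured G c₁ w
    uncoloured₁ {w} w≢v = trans (lookup∘update′ w≢v ∅ _) (lookup-replicate w nothing)

    third : ∀ {b} → LegalMove G c₁ v′ b →
            ¬ WinningStrategy G alice (c₁ [ v′ ]≔ just b)
    third {b} l′ = λ where
        (finished full) →
          -- There are at least `k` vertices, one per part, so two moves do not fill the board.
          let u , u∉ = <⇒misses 2<n (lookup (v ∷ v′ ∷ []))
          in full u (uncoloured₂ (≢-sym (u∉ zero)) (≢-sym (u∉ (suc zero))))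
        (alice-moves _ u e l″ s″) →
          let w , p@(u≢w , _) , w≢v , w≢v′ = others u (coloured⇒≢ v≡ l″) (coloured⇒≢ v′≡ l″)
              -- Up to three colours are on the board by now; `4 ≤ k` leaves Bob another one.
              e′ , fresh = <⇒misses 4≤k (lookup (a ∷ b ∷ e ∷ []))
          in bob-splits _ (move-proper G c₂ l″ proper₂) p
               (lookup∘update u c₂ _)
               (trans (lookup∘update′ (≢-sym u≢w) c₂ _) (uncoloured₂ w≢v w≢v′))
               (fresh (suc (suc zero)))
               (move-unused c₂ u (fresh (suc (suc zero)))
                 (move-unused c₁ v′ (fresh (suc zero))
                   (move-unused ∅ v (fresh zero) (∅-unused e′)))) s″
      where
      c₂ : PartialColouring n k
      c₂ = c₁ [ v′ ]≔ just b

      proper₂ : Proper G c₂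
      proper₂ = move-proper G c₁ l′ proper₁

      uncoloured₂ : ∀ {w} → w ≢ v → w ≢ v′ → Uncoloured G c₂ w
      uncoloured₂ w≢v w≢v′ = trans (lookup∘update′ w≢v′ c₁ _) (uncoloured₁ w≢v)

      v≡ : lookup c₂ v ≡ just a
      v≡ = move-extends G c₁ (proj₁ l′) v a (lookup∘update v ∅ _)

      v′≡ : lookup c₂ v′ ≡ just b
      v′≡ = lookup∘update v′ c₁ _

      coloured⇒≢ : ∀ {u w a e} → lookup c₂ w ≡ just a → LegalMove G c₂ u e → u ≢ w
      coloured⇒≢ eq (unc , _) refl with () ← trans (sym unc) eq

      2<n : 2 < n
      2<n = ≤-trans (s≤s (s≤s (s≤s z≤n))) (≤-trans 4≤k
              (injective⇒≤ {f = proj₁ ∘ inhabited} λ {b} {b′} eq → just-injective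
                (trans (sym (proj₂ (inhabited b)))
                  (trans (cong part eq) (proj₂ (inhabited b′))))))

    second : ¬ WinningStrategy G bob c₁
    second (finished full) = full v′ (uncoloured₁ (≢-sym v≢v′))
    second (bob-moves _ f)
      -- A colour other than `a` is legal at `v′` whether or not `v` and `v′` are adjacent.
      with b , fresh ← <⇒misses (≤-trans (s≤s (s≤s z≤n)) 4≤k) (lookup (a ∷ []))
      with l′ ← unused⇒legal G c₁ v′ (uncoloured₁ (≢-sym v≢v′))
                  (move-unused ∅ v (fresh zero) (∅-unused b)) =
      third l′ (f v′ b l′)

-- The witness graph and its pairing of vertices

module _ (k : ℕ) where

  Vertex : Set
  Vertex = Fin (suc (k + k))

  -- `zero` is the isolated vertex; `reduce` forgets the side, so the i-th vertices of the two
  -- halves form part i.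
  part : Vertex → Maybe (Fin k)
  part zero    = nothing
  part (suc i) = just (reduce (splitAt k i))

  -- Letting it fix the isolated vertex makes it a total involution whose only fixed point is
  -- `zero`.
  partner : Vertex → Vertex
  partner zero    = zero
  partner (suc i) = suc (join k k (swap (splitAt k i)))

  partner-involutive : ∀ v → partner (partner v) ≡ v
  partner-involutive zero = refl
  partner-involutive (suc i)
    rewrite splitAt-join k k (swap (splitAt k i)) | swap-involutive (splitAt k i)
    = cong suc (join-splitAt k k i)

  partner-injective : ∀ {u v} → partner u ≡ partner v → u ≡ v
  partner-injective {u} {v} eq =
    trans (sym (partner-involutive u)) (trans (cong partner eq) (partner-involutive v))

  partner≡0 : ∀ {v} → partner v ≡ zero → v ≡ zero
  partner≡0 {zero} _ = refl

  part-partner : ∀ v → part (partner v) ≡ part v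
  part-partner zero = refl
  part-partner (suc i) rewrite splitAt-join k k (swap (splitAt k i)) with splitAt k i
  ... | inj₁ _ = refl
  ... | inj₂ _ = refl

  partner≢ : ∀ v → v ≢ zero → partner v ≢ v
  partner≢ zero    v≢0 _ = v≢0 refl
  partner≢ (suc i) _ eq = swap≢ (splitAt k i)
    (trans (sym (splitAt-join k k (swap (splitAt k i)))) (cong (splitAt k) (suc-injective eq)))
    where
    swap≢ : (s : Fin k ⊎ Fin k) → swap s ≢ s
    swap≢ (inj₁ _) ()
    swap≢ (inj₂ _) ()

  rejoin : ∀ i {s} → splitAt k i ≡ s → i ≡ join k k s
  rejoin i eq = trans (sym (join-splitAt k k i)) (cong (join k k) eq)

  -- In the same half, equal parts force equal vertices; in opposite halves they force partners.
  same-part : ∀ u v → part u ≡ part v → v ≡ u ⊎ v ≡ partner u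
  same-part zero    zero    _  = inj₁ refl
  same-part (suc i) (suc j) eq with splitAt k i in ui | splitAt k j in vj
  ... | inj₁ b | inj₂ _ rewrite just-injective eq = inj₂ (cong suc (rejoin j vj))
  ... | inj₂ b | inj₁ _ rewrite just-injective eq = inj₂ (cong suc (rejoin j vj))
  ... | inj₁ b | inj₁ _ rewrite just-injective eq =
    inj₁ (cong suc (trans (rejoin j vj) (sym (rejoin i ui))))
  ... | inj₂ b | inj₂ _ rewrite just-injective eq =
    inj₁ (cong suc (trans (rejoin j vj) (sym (rejoin i ui))))

  part≢nothing : ∀ v → v ≢ zero → ∃[ b ] part v ≡ just b
  part≢nothing zero    v≢0 = contradiction refl v≢0
  part≢nothing (suc i) _   = _ , refl

  part-inhabited : ∀ b → ∃[ v ] v ≢ zero × part v ≡ just b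
  part-inhabited b = suc (b ↑ˡ k) , (λ ()) , cong (just ∘ reduce) (splitAt-↑ˡ k b k)

  K₁∪cocktailParty : Graph (suc (k + k))
  K₁∪cocktailParty = multipartite part

  private
    G = K₁∪cocktailParty

  K₁∪cocktailParty-disconnected : ∀ v → v ≢ zero → Disconnected G
  K₁∪cocktailParty-disconnected v v≢0 connected = isolated v≢0 (connected zero v)
    where
    isolated : ∀ {v} → v ≢ zero → ¬ Star (Adj G) zero v
    isolated v≢0 ε        = v≢0 refl
    isolated _   (() ◅ _)

  -- Alice's copying strategy

  Monochrome : PartialColouring (suc (k + k)) k → Set
  Monochrome c = ∀ u v a b → part u ≡ part v → lookup c u ≡ just a → lookup c v ≡ just b → a ≡ b

  -- The k colours around a blocked vertex would come from k distinct parts, one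
  -- of which contains the vertex itself.
  monochrome⇒¬blocked : ∀ c → Fin k → Monochrome c → ¬ Blocked G c
  monochrome⇒¬blocked c a₀ mono (v , _ , nbr) =
    -- The colour `a₀` provides a neighbour of `v`, which shows that `v` lies in some part `b`.
    let b , _ , vb , _ = apart-just (proj₁ (proj₂ (nbr a₀)))
        a , eq         = injective⇒hits nbr-part-injective b
        _ , _ , vb′ , _ , b≢ = parts a
    in b≢ (trans (just-injective (trans (sym vb′) vb)) (sym eq))
    where
    parts : ∀ a → _
    parts a = apart-just (proj₁ (proj₂ (nbr a)))

    nbr-part : Fin k → Fin k
    nbr-part a = proj₁ (proj₂ (parts a))

    nbr-part-≡ : ∀ a → part (proj₁ (nbr a)) ≡ just (nbr-part a)
    nbr-part-≡ a = proj₁ (proj₂ (proj₂ (proj₂ (parts a))))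

    nbr-part-injective : Injective _≡_ _≡_ nbr-part
    nbr-part-injective {a} {a′} eq = mono _ _ a a′
      (trans (nbr-part-≡ a) (trans (cong just eq) (sym (nbr-part-≡ a′))))
      (proj₂ (proj₂ (nbr a))) (proj₂ (proj₂ (nbr a′)))

  -- The invariant at Bob's turns. Comparing values in `Maybe` covers both cases: a part is
  -- untouched, or its two vertices share a colour.
  Mirrored : PartialColouring (suc (k + k)) k → Set
  Mirrored c = ∀ v → lookup c (partner v) ≡ lookup c v

  mirrored⇒monochrome : ∀ c → Mirrored c → Monochrome c
  mirrored⇒monochrome c mirrored u v a b uv cu cv with same-part u v uv
  ... | inj₁ refl = just-injective (trans (sym cu) cv)
  ... | inj₂ refl = just-injective (trans (sym cu) (trans (sym (mirrored u)) cv))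

  module _ (c : PartialColouring (suc (k + k)) k) {v a}
           (zero-coloured : ¬ Uncoloured G c zero) (mirrored : Mirrored c)
           (legal : LegalMove G c v a) where

    private
      c₁ = c [ v ]≔ just a
      c₂ = c₁ [ partner v ]≔ just a

      -- Bob cannot replay the coloured `zero`, the only fixed point of `partner`.
      pv≢v : partner v ≢ v
      pv≢v = partner≢ v λ { refl → zero-coloured (proj₁ legal) }

      pv-uncoloured : Uncoloured G c₁ (partner v)
      pv-uncoloured = trans (lookup∘update′ pv≢v c _) (trans (mirrored v) (proj₁ legal))

      c₂-v : lookup c₂ v ≡ just a
      c₂-v = trans (lookup∘update′ (≢-sym pv≢v) c₁ _) (lookup∘update v c _)

      c₂-pv : lookup c₂ (partner v) ≡ just a
      c₂-pv = lookup∘update (partner v) c₁ _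

      c₂-other : ∀ {u} → u ≢ v → u ≢ partner v → lookup c₂ u ≡ lookup c u
      c₂-other u≢v u≢pv = trans (lookup∘update′ u≢pv c₁ _) (lookup∘update′ u≢v c _)

    -- `v` and its partner have the same neighbours, and `v` is not among them, so Bob's move leaves
    -- the colours around the partner unchanged.
    copy-legal : LegalMove G c₁ (partner v) a
    copy-legal = pv-uncoloured , λ w pvw eq →
      let vw = subst (λ x → Apart x (part w)) (part-partner v) pvw
      in proj₂ legal w vw
           (trans (sym (lookup∘update′ (λ { refl → apart-irrefl vw }) c _)) eq)

    copy-mirrored : Mirrored c₂
    copy-mirrored u with u ≟ v | u ≟ partner v
    ... | yes refl | _        = trans c₂-pv (sym c₂-v)
    ... | no _     | yes refl =
      trans (cong (lookup c₂) (partner-involutive v)) (trans c₂-v (sym c₂-pv))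
    ... | no u≢v   | no u≢pv  =
      trans (c₂-other (λ eq → u≢pv (trans (sym (partner-involutive u)) (cong partner eq)))
                      (λ eq → u≢v (partner-injective eq)))
        (trans (mirrored u) (sym (c₂-other u≢v u≢pv)))

    -- Halfway through a round the board is not mirrored, but all its colours persist in `c₂`, which
    -- is.
    before-copy-monochrome : Monochrome c₁
    before-copy-monochrome u w x y uw cu cw =
      mirrored⇒monochrome c₂ copy-mirrored u w x y uw
        (move-extends G c₁ pv-uncoloured u x cu) (move-extends G c₁ pv-uncoloured w y cw)

    copy-zero-coloured : ¬ Uncoloured G c₂ zero
    copy-zero-coloured unc with zero ≟ v | zero ≟ partner v
    ... | yes refl | _        = zero-coloured (proj₁ legal)
    ... | no _     | yes 0≡pv with () ← trans (sym unc) (trans (cong (lookup c₂) 0≡pv) c₂-pv)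
    ... | no 0≢v   | no 0≢pv  = zero-coloured (trans (sym (c₂-other 0≢v 0≢pv)) unc)

  -- Induction on the number of uncoloured vertices, two fewer after each round. On a full board Bob
  -- has no legal move, and the recursion stops.
  copying-wins : ∀ c → Fin k → ¬ Uncoloured G c zero → Mirrored c → Acc _<_ (#uncoloured c) →
                 WinningStrategy G bob c
  copying-wins c a₀ z mirrored (acc rec) =
    bob-moves (monochrome⇒¬blocked c a₀ (mirrored⇒monochrome c mirrored)) λ v a l →
      let l′ = copy-legal c z mirrored l
      in alice-moves
           (monochrome⇒¬blocked (c [ v ]≔ just a) a₀ (before-copy-monochrome c z mirrored l))
           (partner v) a l′
           (copying-wins _ a₀ (copy-zero-coloured c z mirrored l) (copy-mirrored c z mirrored l)
             (rec (<-trans (#uncoloured-decreases (c [ v ]≔ just a) (partner v) a (proj₁ l′))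
                           (#uncoloured-decreases c v a (proj₁ l)))))

  alice-wins : Fin k → AliceWins G k
  alice-wins a₀ =
    alice-moves (monochrome⇒¬blocked ∅ a₀ λ u _ a _ _ eq → contradiction eq (∅-unused a u))
      -- Since `partner` fixes `zero`, this opening leaves a mirrored board.
      zero a₀ (refl , λ _ ())
      (copying-wins _ a₀ (λ ()) mirrored (<-wellFounded _))
    where
    mirrored : Mirrored (∅ [ zero ]≔ just a₀)
    mirrored zero    = refl
    mirrored (suc i) = trans (lookup-replicate (join k k (swap (splitAt k i))) nothing)
                             (sym (lookup-replicate i nothing))

  -- Vertex-deleted subgraphs

  module _ (x : Vertex) where

    private
      ι : Fin (k + k) → Vertex
      ι = punchIn x

    survivor : ∀ v → v ≢ x → ∃[ u ] ι u ≡ v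
    survivor v v≢x = punchOut (≢-sym v≢x) , punchIn-punchOut (≢-sym v≢x)

    -- A deleted representative is replaced by its partner, so every part survives.
    survivor-inhabited : ∀ b → ∃[ u ] part (ι u) ≡ just b
    survivor-inhabited b with v , v≢0 , vb ← part-inhabited b with v ≟ x
    ... | no v≢x   = let u , eq = survivor v v≢x in u , trans (cong part eq) vb
    ... | yes refl =
      let u , eq = survivor (partner v) (partner≢ v v≢0)
      in u , trans (cong part eq) (trans (part-partner v) vb)

    Partners-x : Fin (k + k) → Fin (k + k) → Set
    Partners-x = Partners (G -ᵍ x) (part ∘ ι) id survivor-inhabited

    partner-survives : ∀ u → ι u ≢ zero → ι u ≢ partner x →
                       ∃[ w ] ι w ≡ partner (ι u) × Partners-x u w
    partner-survives u u≢0 u≢px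
      with w , eq ← survivor (partner (ι u))
                      (λ pu≡x → u≢px (trans (sym (partner-involutive (ι u))) (cong partner pu≡x)))
      with b , ub ← part≢nothing (ι u) u≢0 =
      w , eq , (λ { refl → partner≢ (ι u) u≢0 (sym eq) })
        , b , ub , trans (cong part eq) (trans (part-partner (ι u)) ub)

    OnlyLonely-x : Fin (k + k) → Fin (k + k) → Set
    OnlyLonely-x = OnlyLonely (G -ᵍ x) (part ∘ ι) id survivor-inhabited

    -- The hypotheses exclude `x` being `zero`; then `zero` and the partner of `x` are the two
    -- vertices left alone. Both orders are given because Alice may open on either.
    zero-partner-lonely : ∀ v v′ → ι v ≡ zero → ι v′ ≡ partner x →
                          OnlyLonely-x v v′ × OnlyLonely-x v′ v
    zero-partner-lonely v v′ v≡0 v′≡px =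
        (v≢v′ , others)
      , (≢-sym v≢v′ , λ u u≢v′ u≢v →
           let w , p , w≢v , w≢v′ = others u u≢v u≢v′ in w , p , w≢v′ , w≢v)
      where
      v≢v′ : v ≢ v′
      v≢v′ refl = punchInᵢ≢i x v (trans v≡0 (sym (partner≡0 (trans (sym v′≡px) v≡0))))

      others : ∀ u → u ≢ v → u ≢ v′ → ∃[ w ] Partners-x u w × w ≢ v × w ≢ v′
      others u u≢v u≢v′
        with w , w≡pu , p ← partner-survives u
               (λ u≡0 → u≢v (punchIn-injective x u v (trans u≡0 (sym v≡0))))
               (λ u≡px → u≢v′ (punchIn-injective x u v′ (trans u≡px (sym v′≡px)))) =
        w , p
          , (λ { refl → u≢v (punchIn-injective x u v
                          (trans (partner≡0 (trans (sym w≡pu) v≡0)) (sym v≡0))) })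
          , (λ { refl → punchInᵢ≢i x u (partner-injective (trans (sym w≡pu) v′≡px)) })

    deletion-loses : 4 ≤ k → ¬ AliceWins (G -ᵍ x) k
    deletion-loses 4≤k = alice-opens⇒loses (G -ᵍ x) (part ∘ ι) id survivor-inhabited 4≤k pairing
      where
      pairing : ∀ v → (∃[ w ] Partners-x v w) ⊎ (∃[ v′ ] OnlyLonely-x v v′)
      -- If `x` is `zero`, both tested values equal `x`, which `ι` misses, so only the last case
      -- occurs. Otherwise the first two cases are the unpaired vertices.
      pairing v with ι v ≟ zero | ι v ≟ partner x
      ... | yes v≡0 | _ =
        let v′ , v′≡px = survivor (partner x)
              (partner≢ x λ x≡0 → punchInᵢ≢i x v (trans v≡0 (sym x≡0)))
        in inj₂ (v′ , proj₁ (zero-partner-lonely v v′ v≡0 v′≡px))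
      ... | no v≢0 | yes v≡px =
        let v′ , v′≡0 = survivor zero λ { refl → v≢0 v≡px }
        in inj₂ (v′ , proj₂ (zero-partner-lonely v′ v v′≡0 v≡px))
      ... | no v≢0 | no v≢px =
        let w , _ , p = partner-survives v v≢0 v≢px in inj₁ (w , p)

proposition5 : ∀ (k : ℕ) → k ≥ 4 →
    ∃[ n ] Σ[ G ∈ Graph n ] (Disconnected G × GameVertexCritical k G)
proposition5 k@(suc _) k≥4 =
    suc (k + k) , K₁∪cocktailParty k
  , K₁∪cocktailParty-disconnected k (suc zero) (λ ())
  , critical (K₁∪cocktailParty k) (alice-wins k zero)
      (λ _ → alice-needs (K₁∪cocktailParty k) (part k) id
               λ b → let v , _ , vb = part-inhabited k b in v , vb)
      (λ x → deletion-loses k x k≥4)
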